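{- For every integer $n \geq 4$, the smallest string attractor of the $n$-th Thue-Morse word $t_n$ has size exactly $4$; that is, $\gamma(t_n) = 4$.
   Context: Strings are over the binary alphabet $\Sigma=\{\mathtt{a},\mathtt{b}\}$, and $|w|$ denotes the length of $w$. Positions of a string $w$ are numbered $1,\ldots,|w|$; $w[i]$ is the $i$-th symbol, and $w[i..j]=w[i]w[i+1]\cdots w[j]$ for $1\le i\le j\le |w|$. For $w\in\Sigma^*$, $\overline{w}$ is the string obtained from $w$ by exchanging all $\mathtt{a}$'s and $\mathtt{b}$'s. Thue-Morse words: $t_0=\mathtt{a}$, and $t_n=t_{n-1}\overline{t_{n-1}}$ for $n>0$ (so $|t_n|=2^n$). String attractor: a set $\Gamma\subseteq\{1,\ldots,|w|\}$ of positions in $w$ is a string attractor of $w$ if for every non-empty substring (contiguous factor) $x$ of $w$ there is an occurrence $w[i..j]=x$ of $x$ in $w$ that contains a position in $\Gamma$, i.e., some $p\in\Gamma$ with $i\le p\le j$. $\gamma(w)$ denotes the minimum cardinality of a string attractor of $w$. -}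

module Defs where

open import Data.Fin using (Fin; toℕ; _≤_)
open import Data.Fin.Subset using (Subset; _∈_; ∣_∣)
open import Data.List using (List; []; _∷_; _++_; [_]; length; map; take; drop)
open import Data.List.Relation.Binary.Infix.Heterogeneous using (Infix)
open import Data.Nat using (ℕ; zero; suc; _∸_)
import Data.Nat as ℕ
open import Data.Product using (_×_; ∃-syntax)
open import Relation.Binary.PropositionalEquality using (_≡_; _≢_)

data Letter : Set where
  a b : Letter

Word : Set
Word = List Letter

-- Positions are numbered from 0 rather than from 1.
Position : Word → Set
Position w = Fin (length w)

-- The factor from i to j, both ends included; only meaningful for i ≤ j.
_[_⋯_] : (w : Word) → Position w → Position w → Word
w [ i ⋯ j ] = take (suc (toℕ j ∸ toℕ i)) (drop (toℕ i) w)

swap : Letter → Letter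
swap a = b
swap b = a

complement : Word → Word
complement = map swap

thueMorse : ℕ → Word
thueMorse zero    = [ a ]
thueMorse (suc n) = thueMorse n ++ complement (thueMorse n)

IsSubstringOf : Word → Word → Set
IsSubstringOf x w = Infix _≡_ x w

IsStringAttractor : (w : Word) → Subset (length w) → Set
IsStringAttractor w Γ =
  ∀ (x : Word) → x ≢ [] → IsSubstringOf x w →
  ∃[ i ] ∃[ j ] i ≤ j × w [ i ⋯ j ] ≡ x ×
    (∃[ p ] p ∈ Γ × i ≤ p × p ≤ j)

-- γ(w) = k, as a relation: k is the least cardinality of an attractor of w.
γ_≔_ : Word → ℕ → Set
γ w ≔ k =
  (∃[ Γ ] IsStringAttractor w Γ × ∣ Γ ∣ ≡ k) ×
  (∀ Γ → IsStringAttractor w Γ → k ℕ.≤ ∣ Γ ∣)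

{-# OPTIONS --safe #-}
-- The Thue–Morse words are iterates of φ : a ↦ ab, b ↦ ba.
--
-- Four positions suffice: in t₃ = abbabaab every factor of length at least 2 has an occurrence across
-- one of the four cuts ab|b|a|ba|ab, and this property passes from w to φ w with the cuts doubled,
-- since a factor of φ w is the image of a factor of w with at most one letter removed at each end.
-- The letters to the right of the cuts then form an attractor.
--
-- Four positions are needed: for cube-free w and x of length at least 2, φ x occurs in φ w only as the
-- image of an occurrence of x in w, so halving the positions of an attractor of t (n + 1) gives
-- positions that meet every such factor of t n. Down at t₄ a few factors already require four of them.
module Submission where

open import Defs
open import Data.Fin using (toℕ; fromℕ<)
open import Data.Fin.Properties using (toℕ<n; toℕ-fromℕ<)
open import Data.Fin.Subset using (Subset; inside; outside; ⊥; ⁅_⁆; _∪_; ∣_∣) renaming (_∈_ to _∈ₛ_)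
open import Data.Fin.Subset.Properties using (∣⊥∣≡0; ∣⁅x⁆∣≡1; x∈⁅x⁆; x∈p∪q⁺)
open import Data.List using (List; []; _∷_; _++_; [_]; length; map; take; drop; filter; upTo)
open import Data.List.Membership.Propositional using (_∈_; find)
open import Data.List.Membership.Propositional.Properties
  using (∈-∃++; ∈-++⁺ˡ; ∈-++⁺ʳ; ∈-++⁻; ∈-map⁺; ∈-filter⁺; ∈-upTo⁺)
open import Data.List.Properties
  using (++-assoc; ++-conicalˡ; ++-identityʳ; length-++; length-++-sucʳ; length-map; length-take;
         length-drop; ∷-injectiveˡ; ∷-injectiveʳ; take++drop≡id; ≡-dec)
open import Data.List.Relation.Binary.Infix.Heterogeneous using (MkView; toView; fromView)
open import Data.List.Relation.Binary.Pointwise using (Pointwise-≡⇒≡; ≡⇒Pointwise-≡)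
open import Data.List.Relation.Unary.All using (All; []; _∷_; zipWith)
open import Data.List.Relation.Unary.AllPairs using ([]; _∷_)
open import Data.List.Relation.Unary.Any using (Any; here; there; any?)
open import Data.List.Relation.Unary.Unique.Propositional using (Unique)
open import Data.Nat
  using (ℕ; zero; suc; _+_; _*_; _∸_; _/_; _⊓_; _≤_; _<_; z≤n; s≤s; s≤s⁻¹)
open import Data.Nat.DivMod using (m*n/n≡m; /-monoˡ-≤; m<n*o⇒m/o<n)
open import Data.Nat.Properties
open import Data.Product using (Σ; _×_; _,_; ∃-syntax; proj₂)
open import Data.Sum using (_⊎_; inj₁; inj₂)
open import Data.Vec using ([]; _∷_; here; there)
open import Function using (_∘_)
open import Relation.Binary.Definitions using (DecidableEquality)
open import Relation.Binary.PropositionalEquality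
  using (_≡_; _≢_; refl; sym; trans; cong; cong₂; subst; subst₂; module ≡-Reasoning)
open import Relation.Nullary using (¬_; yes; no; contradiction)
open import Relation.Nullary.Decidable using (True; toWitness; _×-dec_; _⊎-dec_; _→-dec_)

-- Letters and the morphism φ

_≟ˡ_ : DecidableEquality Letter
a ≟ˡ a = yes refl
a ≟ˡ b = no λ ()
b ≟ˡ a = no λ ()
b ≟ˡ b = yes refl

_≟ʷ_ : DecidableEquality Word
_≟ʷ_ = ≡-dec _≟ˡ_

swap-≢ : ∀ c → swap c ≢ c
swap-≢ a ()
swap-≢ b ()

swap-involutive : ∀ c → swap (swap c) ≡ c
swap-involutive a = refl
swap-involutive b = refl

φ : Word → Word
φ []      = []
φ (c ∷ w) = c ∷ swap c ∷ φ w

φ-++ : ∀ u v → φ (u ++ v) ≡ φ u ++ φ v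
φ-++ []      v = refl
φ-++ (c ∷ u) v = cong (λ w → c ∷ swap c ∷ w) (φ-++ u v)

φ-complement : ∀ w → complement (φ w) ≡ φ (complement w)
φ-complement []      = refl
φ-complement (c ∷ w) = cong (λ z → swap c ∷ swap (swap c) ∷ z) (φ-complement w)

length-φ : ∀ w → length (φ w) ≡ length w * 2
length-φ []      = refl
length-φ (c ∷ w) = cong (suc ∘ suc) (length-φ w)

-- φ commutes with concatenation and with complement, so it turns the doubling recursion at one
-- level into that at the next.
thueMorse-suc : ∀ n → thueMorse (suc n) ≡ φ (thueMorse n)
thueMorse-suc zero    = refl
thueMorse-suc (suc n) = begin
  thueMorse (suc n) ++ complement (thueMorse (suc n))
    ≡⟨ cong (λ w → w ++ complement w) (thueMorse-suc n) ⟩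
  φ (thueMorse n) ++ complement (φ (thueMorse n))
    ≡⟨ cong (φ (thueMorse n) ++_) (φ-complement (thueMorse n)) ⟩
  φ (thueMorse n) ++ φ (complement (thueMorse n))
    ≡⟨ φ-++ (thueMorse n) _ ⟨
  φ (thueMorse (suc n)) ∎
  where open ≡-Reasoning

-- Factorizations of φ-images

-- A view of the ways to split φ w in two: at a block boundary, or in the middle of the block of
-- `c`.
data Cut : Word → Word → Word → Set where
  between : ∀ u v → Cut (u ++ v) (φ u) (φ v)
  within  : ∀ u c v → Cut (u ++ c ∷ v) (φ u ++ [ c ]) (swap c ∷ φ v)

cut : ∀ w u v → φ w ≡ u ++ v → Cut w u v
cut w       []          v refl = between [] w
cut []      (_ ∷ _)     v ()
cut (c ∷ w) (_ ∷ [])    v refl = within [] c w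
cut (c ∷ w) (_ ∷ _ ∷ u) v eq
  with refl ← ∷-injectiveˡ eq
  with refl ← ∷-injectiveˡ (∷-injectiveʳ eq)
  with cut w u v (∷-injectiveʳ (∷-injectiveʳ eq))
... | between u′ v′  = between (c ∷ u′) v′
... | within u′ d v′ = within (c ∷ u′) d v′

φ-prefix : ∀ w x v → φ w ≡ φ x ++ v → ∃[ v′ ] w ≡ x ++ v′
φ-prefix w       []      v eq = w , refl
φ-prefix []      (_ ∷ _) v ()
φ-prefix (c ∷ w) (_ ∷ x) v eq
  with refl ← ∷-injectiveˡ eq
  with v′ , refl ← φ-prefix w x v (∷-injectiveʳ (∷-injectiveʳ eq)) = v′ , refl

-- Occurrences of factors

record OccursAt (i : ℕ) (x w : Word) : Set where
  constructor occurs
  field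
    before after  : Word
    factorization : before ++ x ++ after ≡ w
    start         : length before ≡ i

occurs-trans : ∀ {i j x y w} → OccursAt i x y → OccursAt j y w → OccursAt (j + i) x w
occurs-trans {x = x} (occurs u v refl refl) (occurs u′ v′ refl refl) =
  occurs (u′ ++ u) (v ++ v′) eq (length-++ u′)
  where
  open ≡-Reasoning
  eq : (u′ ++ u) ++ x ++ v ++ v′ ≡ u′ ++ (u ++ x ++ v) ++ v′
  eq = begin
    (u′ ++ u) ++ x ++ v ++ v′   ≡⟨ ++-assoc u′ u _ ⟩
    u′ ++ u ++ x ++ v ++ v′     ≡⟨ cong (λ z → u′ ++ u ++ z) (++-assoc x v v′) ⟨
    u′ ++ u ++ (x ++ v) ++ v′   ≡⟨ cong (u′ ++_) (++-assoc u (x ++ v) v′) ⟨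
    u′ ++ (u ++ x ++ v) ++ v′   ∎

occurs-φ : ∀ {i x w} → OccursAt i x w → OccursAt (i * 2) (φ x) (φ w)
occurs-φ {x = x} (occurs u v refl refl) =
  occurs (φ u) (φ v) (sym (trans (φ-++ u _) (cong (φ u ++_) (φ-++ x v)))) (length-φ u)

occurs-take : ∀ {i x w} → OccursAt i x w → take (length x) (drop i w) ≡ x
occurs-take {x = x} (occurs u v refl refl) = drop-before u
  where
  take-prefix : ∀ y → take (length y) (y ++ v) ≡ y
  take-prefix []      = refl
  take-prefix (c ∷ y) = cong (c ∷_) (take-prefix y)
  drop-before : ∀ u → take (length x) (drop (length u) (u ++ x ++ v)) ≡ x
  drop-before []      = take-prefix x
  drop-before (_ ∷ u) = drop-before u

occurs-bound : ∀ {i x w} → OccursAt i x w → i + length x ≤ length w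
occurs-bound {x = x} (occurs u v refl refl) = begin
  length u + length x              ≤⟨ +-monoʳ-≤ (length u) (m≤m+n (length x) (length v)) ⟩
  length u + (length x + length v) ≡⟨ cong (length u +_) (length-++ x) ⟨
  length u + length (x ++ v)       ≡⟨ length-++ u ⟨
  length (u ++ x ++ v)             ∎
  where open ≤-Reasoning

take-occurs : ∀ i l w → i + l ≤ length w → OccursAt i (take l (drop i w)) w
take-occurs i l w i+l≤w = occurs (take i w) (drop l (drop i w)) eq
  (trans (length-take i w) (m≤n⇒m⊓n≡m (m+n≤o⇒m≤o i i+l≤w)))
  where
  eq : take i w ++ take l (drop i w) ++ drop l (drop i w) ≡ w
  eq = trans (cong (take i w ++_) (take++drop≡id l (drop i w))) (take++drop≡id i w)

length-take-drop : ∀ i l (w : Word) → i + l ≤ length w → length (take l (drop i w)) ≡ l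
length-take-drop i l w i+l≤w = begin
  length (take l (drop i w))     ≡⟨ length-take l (drop i w) ⟩
  l ⊓ length (drop i w)          ≡⟨ m≤n⇒m⊓n≡m l≤ ⟩
  l                              ∎
  where
  open ≡-Reasoning
  l≤ : l ≤ length (drop i w)
  l≤ = subst (l ≤_) (sym (length-drop i w)) (m+n≤o⇒m≤o∸n l (subst (_≤ length w) (+-comm i l) i+l≤w))

occurs⇒substring : ∀ {i x w} → OccursAt i x w → IsSubstringOf x w
occurs⇒substring (occurs u v refl _) = fromView (MkView u (≡⇒Pointwise-≡ refl) v)

substring⇒occurs : ∀ {x w} → IsSubstringOf x w → ∃[ i ] OccursAt i x w
substring⇒occurs x⊑w with MkView u x≡ v ← toView x⊑w
  with refl ← Pointwise-≡⇒≡ x≡ = length u , occurs u v refl refl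

-- On concrete words this list evaluates, so matching on membership in it runs through all
-- occurrences.
starts : Word → Word → List ℕ
starts x w = filter (λ i → take (length x) (drop i w) ≟ʷ x) (upTo (suc (length w)))

start∈starts : ∀ {i x w} → OccursAt i x w → i ∈ starts x w
start∈starts {i} {x} {w} o =
  ∈-filter⁺ (λ i → take (length x) (drop i w) ≟ʷ x)
    (∈-upTo⁺ (s≤s (m+n≤o⇒m≤o i (occurs-bound o)))) (occurs-take o)

-- Lower bound: desubstitution

-- Only cubes of a single letter are excluded, which is weaker than the usual notion.
CubeFree : Word → Set
CubeFree w = ∀ c u v → w ≢ u ++ c ∷ c ∷ c ∷ v

φ-no-leading-square : ∀ w c v → φ w ≢ c ∷ c ∷ v
φ-no-leading-square (_ ∷ w) c v eq
  with refl ← ∷-injectiveˡ eq = swap-≢ c (∷-injectiveˡ (∷-injectiveʳ eq))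

-- Of the two adjacent pairs in ccc one is a block, and the letters of a block differ.
φ-cubeFree : ∀ w → CubeFree (φ w)
φ-cubeFree w c u v eq = go (cut w u _ eq) refl
  where
  go : ∀ {w u r} → Cut w u r → ¬ r ≡ c ∷ c ∷ c ∷ v
  go (between _ r)  r≡ = φ-no-leading-square r c _ r≡
  go (within _ _ r) r≡ = φ-no-leading-square r c _ (∷-injectiveʳ r≡)

-- So an occurrence of φ x, with x of length at least 2, that starts inside a block of φ w puts a
-- cube in w.
φ-odd-prefix : ∀ c (r : Word) {d e} {v : Word} →
               _≡_ {A = Word} (swap c ∷ φ r) (d ∷ swap d ∷ e ∷ swap e ∷ v) → ∃[ r′ ] r ≡ c ∷ c ∷ r′
φ-odd-prefix c (f ∷ g ∷ r) eq₀
  with eq₁ ← ∷-injectiveʳ eq₀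
  with eq₂ ← ∷-injectiveʳ eq₁
  with refl ← ∷-injectiveˡ eq₀ | refl ← ∷-injectiveˡ eq₁
     | refl ← ∷-injectiveˡ eq₂ | refl ← ∷-injectiveˡ (∷-injectiveʳ eq₂) =
    r , cong₂ (λ f g → f ∷ g ∷ r) (swap-involutive c)
          (trans (swap-involutive _) (swap-involutive c))

-- If the occurrence starts between blocks, the blocks of φ x can be read back; if inside one, w
-- contains a cube. A single letter would not do: φ b = ba occurs inside φ (aa) = abab.
desubstitute : ∀ {i x w} → CubeFree w → 2 ≤ length x → OccursAt i (φ x) (φ w) →
               ∃[ k ] i ≡ k * 2 × OccursAt k x w
desubstitute {x = x} {w} cf 2≤x (occurs u v eq refl) = go x cf 2≤x (cut w u _ (sym eq)) refl
  where
  go : ∀ {w u r} x → CubeFree w → 2 ≤ length x → Cut w u r → r ≡ φ x ++ v →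
       ∃[ k ] length u ≡ k * 2 × OccursAt k x w
  go x cf _ (between u r) r≡ with v′ , refl ← φ-prefix r x v r≡ =
    length u , length-φ u , occurs u v′ refl refl
  go (_ ∷ _ ∷ _) cf _ (within u c r) r≡ with _ , refl ← φ-odd-prefix c r r≡ =
    contradiction refl (cf c u _)
  go (_ ∷ []) _ (s≤s ())

-- Lower bound: positions that meet every factor

-- Numbers in a list, not a `Subset`, so that halving is a `map` and keeps the length even where
-- positions collide.
Hits : List ℕ → Word → Word → Set
Hits ps x w = ∃[ i ] ∃[ p ] OccursAt i x w × p ∈ ps × i ≤ p × p < i + length x

-- Single letters are left out, as `desubstitute` does not cover them.
HitsAll : List ℕ → Word → Set
HitsAll ps w = ∀ {i x} → 2 ≤ length x → OccursAt i x w → Hits ps x w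

-- φ x has a hit occurrence, which desubstitutes to one of x at k; halving takes [2k, 2(k + |x|))
-- into [k, k + |x|).
hitsAll-φ⁻ : ∀ {ps w} → CubeFree w → HitsAll ps (φ w) → HitsAll (map (_/ 2) ps) w
hitsAll-φ⁻ {ps} {w} cf hits {x = x} 2≤x o
  with i , p , o′ , p∈ps , i≤p , p< ← hits (subst (2 ≤_) (sym (length-φ x)) (≤-trans 2≤x (m≤m*n _ 2)))
                                           (occurs-φ o)
  with k , refl , o″ ← desubstitute cf 2≤x o′ =
    k , p / 2 , o″ , ∈-map⁺ (_/ 2) p∈ps
      , subst (_≤ p / 2) (m*n/n≡m k 2) (/-monoˡ-≤ 2 i≤p)
      , m<n*o⇒m/o<n (subst (p <_) end≡ p<)
  where
  end≡ : k * 2 + length (φ x) ≡ (k + length x) * 2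
  end≡ = trans (cong (k * 2 +_) (length-φ x)) (sym (*-distribʳ-+ 2 k (length x)))

distinct-members : ∀ {A : Set} {xs ys : List A} → Unique xs → All (_∈ ys) xs → length xs ≤ length ys
distinct-members []           []                = z≤n
distinct-members {xs = x ∷ xs} (x∉xs ∷ xs!) (x∈ys ∷ xs⊆ys)
  with l , r , refl ← ∈-∃++ x∈ys =
    subst (suc (length xs) ≤_) (sym (length-++-sucʳ l x r))
      (s≤s (distinct-members xs! (zipWith avoid (x∉xs , xs⊆ys))))
  where
  avoid : ∀ {y} → x ≢ y × y ∈ l ++ x ∷ r → y ∈ l ++ r
  avoid (x≢y , y∈) with ∈-++⁻ l y∈
  ... | inj₁ y∈l          = ∈-++⁺ˡ y∈l
  ... | inj₂ (here y≡x)   = contradiction (sym y≡x) x≢y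
  ... | inj₂ (there y∈r)  = ∈-++⁺ʳ l y∈r

increasing₄-members : ∀ {p q r s ps} → p ∈ ps → q ∈ ps → r ∈ ps → s ∈ ps →
                      p < q → q < r → r < s → 4 ≤ length ps
increasing₄-members p∈ q∈ r∈ s∈ p<q q<r r<s = distinct-members
  ( (<⇒≢ p<q ∷ <⇒≢ (<-trans p<q q<r) ∷ <⇒≢ (<-trans p<q (<-trans q<r r<s)) ∷ [])
  ∷ (<⇒≢ q<r ∷ <⇒≢ (<-trans q<r r<s) ∷ [])
  ∷ (<⇒≢ r<s ∷ [])
  ∷ [] ∷ [])
  (p∈ ∷ q∈ ∷ r∈ ∷ s∈ ∷ [])

hits-start : ∀ {ps x w} → Hits ps x w →
             ∃[ i ] i ∈ starts x w × ∃[ p ] p ∈ ps × i ≤ p × p < i + length x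
hits-start (i , p , o , p∈ps , i≤p , p<) = i , start∈starts o , p , p∈ps , i≤p , p<

-- In t₄ the factors bbab, aabb, bbaa and babb occur once, at 1, 5, 7 and 11, and aa occurs at 5 and
-- at 9. Either occurrence of aa is disjoint from three of the others, which are pairwise disjoint.
hitsAll-t₄ : ∀ {ps} → HitsAll ps (thueMorse 4) → 4 ≤ length ps
hitsAll-t₄ {ps} hits = go
  (hits-factor (b ∷ b ∷ a ∷ b ∷ []) 1)
  (hits-factor (a ∷ a ∷ b ∷ b ∷ []) 5)
  (hits-factor (b ∷ b ∷ a ∷ a ∷ []) 7)
  (hits-factor (b ∷ a ∷ b ∷ b ∷ []) 11)
  (hits-factor (a ∷ a ∷ []) 5)
  where
  HitsFactor : Word → Set
  HitsFactor x = ∃[ i ] i ∈ starts x (thueMorse 4) × ∃[ p ] p ∈ ps × i ≤ p × p < i + length x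

  hits-factor : ∀ x i {_ : True (2 ≤? length x)} {_ : True (take (length x) (drop i (thueMorse 4)) ≟ʷ x)}
                {_ : True (i + length x ≤? 16)} → HitsFactor x
  hits-factor x i {2≤x} {x≡} {i+x≤16} = hits-start (hits (toWitness 2≤x)
    (subst (λ y → OccursAt i y (thueMorse 4)) (toWitness x≡)
      (take-occurs i (length x) (thueMorse 4) (toWitness i+x≤16))))

  go : HitsFactor (b ∷ b ∷ a ∷ b ∷ []) → HitsFactor (a ∷ a ∷ b ∷ b ∷ []) →
       HitsFactor (b ∷ b ∷ a ∷ a ∷ []) → HitsFactor (b ∷ a ∷ b ∷ b ∷ []) →
       HitsFactor (a ∷ a ∷ []) → 4 ≤ length ps
  go (_ , here refl , p , p∈ , _ , p<5) (_ , here refl , q , q∈ , 5≤q , q<9)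
     (_ , here refl , r , r∈ , 7≤r , r<11) (_ , here refl , s , s∈ , 11≤s , _) =
    λ where
      (_ , here refl , t , t∈ , 5≤t , t<7) →
        increasing₄-members p∈ t∈ r∈ s∈ (<-≤-trans p<5 5≤t) (<-≤-trans t<7 7≤r) (<-≤-trans r<11 11≤s)
      (_ , there (here refl) , t , t∈ , 9≤t , t<11) →
        increasing₄-members p∈ q∈ t∈ s∈ (<-≤-trans p<5 5≤q) (<-≤-trans q<9 9≤t) (<-≤-trans t<11 11≤s)

-- Halving repeatedly leads down to t₄. Each word on the way is a φ-image and so free of letter
-- cubes.
hitsAll-thueMorse : ∀ k {ps} → HitsAll ps (thueMorse (4 + k)) → 4 ≤ length ps
hitsAll-thueMorse zero    hits = hitsAll-t₄ hits
hitsAll-thueMorse (suc k) {ps} hits =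
  subst (4 ≤_) (length-map (_/ 2) ps) (hitsAll-thueMorse k
    (hitsAll-φ⁻ (subst CubeFree (sym (thueMorse-suc (3 + k))) (φ-cubeFree _))
      (subst (HitsAll ps) (thueMorse-suc (4 + k)) hits)))

-- From subsets to lists of positions

positions : ∀ {n} → Subset n → List ℕ
positions []            = []
positions (inside ∷ Γ)  = 0 ∷ map suc (positions Γ)
positions (outside ∷ Γ) = map suc (positions Γ)

length-positions : ∀ {n} (Γ : Subset n) → length (positions Γ) ≡ ∣ Γ ∣
length-positions []            = refl
length-positions (inside ∷ Γ)  = cong suc (trans (length-map suc (positions Γ)) (length-positions Γ))
length-positions (outside ∷ Γ) = trans (length-map suc (positions Γ)) (length-positions Γ)

∈-positions : ∀ {n} {Γ : Subset n} {p} → p ∈ₛ Γ → toℕ p ∈ positions Γ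
∈-positions                     here       = here refl
∈-positions {Γ = inside ∷ _}  (there p∈Γ) = there (∈-map⁺ suc (∈-positions p∈Γ))
∈-positions {Γ = outside ∷ _} (there p∈Γ) = ∈-map⁺ suc (∈-positions p∈Γ)

nonempty : ∀ {x : Word} {k} → suc k ≤ length x → x ≢ []
nonempty () refl

attractor⇒hitsAll : ∀ {w Γ} → IsStringAttractor w Γ → HitsAll (positions Γ) w
attractor⇒hitsAll {w} attracts 2≤x o
  with i , j , i≤j , refl , p , p∈Γ , i≤p , p≤j ← attracts _ (nonempty 2≤x) (occurs⇒substring o) =
    toℕ i , toℕ p , take-occurs (toℕ i) l w end≤ , ∈-positions p∈Γ , i≤p ,
    subst (λ m → toℕ p < toℕ i + m) (sym (length-take-drop (toℕ i) l w end≤))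
      (≤-trans (s≤s p≤j) (≤-reflexive (sym end≡)))
  where
  l : ℕ
  l = suc (toℕ j ∸ toℕ i)
  end≡ : toℕ i + l ≡ suc (toℕ j)
  end≡ = trans (+-suc (toℕ i) _) (cong suc (m+[n∸m]≡n i≤j))
  end≤ : toℕ i + l ≤ length w
  end≤ = ≤-trans (≤-reflexive end≡) (toℕ<n j)

-- Upper bound: cuts straddled by every factor

-- g stands for the cut between the positions g ∸ 1 and g. Unlike containment of a position,
-- straddling a cut survives both φ and the trimming of a letter at either end.
Straddles : List ℕ → Word → Word → Set
Straddles gs x w = ∃[ i ] ∃[ g ] OccursAt i x w × g ∈ gs × i < g × g < i + length x

-- A single letter has no cut inside it, hence the bound on the length.
StraddlesAll : List ℕ → Word → Set
StraddlesAll gs w = ∀ {i x} → 2 ≤ length x → OccursAt i x w → Straddles gs x w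

-- Serves twice: for blocks, in `cover₂`, and for single letters, in `straddlesAll⇒hits`.
Squares : Word → Set
Squares w = ∀ c → ∃[ i ] OccursAt i (c ∷ c ∷ []) w

-- The start of y in φ w is not recorded, so `cover₂` may pass to another occurrence of y.
record Cover (y w : Word) : Set where
  constructor covered
  field
    {position}   : ℕ
    {factor}     : Word
    occurrence   : OccursAt position factor w
    left right   : Word
    image        : left ++ y ++ right ≡ φ factor
    short-left   : length left ≤ 1
    short-right  : length right ≤ 1

-- φ w is cut in front of y and then behind it; an end that falls inside a block gets the missing
-- letter of that block back.
cover : ∀ {i y w} → 2 ≤ length y → OccursAt i y (φ w) → Cover y w
cover {y = y} {w} 2≤y (occurs u v eq refl) = left (cut w u _ (sym eq)) refl
  where
  right-between : ∀ {r y v} u → Cut r y v → Cover y (u ++ r)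
  right-between u (between y v) =
    covered (occurs u v refl refl) [] [] (++-identityʳ (φ y)) z≤n z≤n
  right-between u (within y c v) =
    covered (occurs u v (cong (u ++_) (++-assoc y [ c ] v)) refl) [] [ swap c ]
      (trans (++-assoc (φ y) [ c ] [ swap c ]) (sym (φ-++ y [ c ]))) z≤n ≤-refl

  right-within : ∀ {r y v} u c → Cut r y v → Cover (swap c ∷ y) (u ++ c ∷ r)
  right-within u c (between y v) =
    covered (occurs {x = c ∷ y} u v refl refl) [ c ] []
      (cong (λ z → c ∷ swap c ∷ z) (++-identityʳ (φ y))) ≤-refl z≤n
  right-within u c (within y d v) =
    covered (occurs {x = c ∷ y ++ [ d ]} u v (cong (λ z → u ++ c ∷ z) (++-assoc y [ d ] v)) refl)
      [ c ] [ swap d ]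
      (cong (λ z → c ∷ swap c ∷ z) (trans (++-assoc (φ y) [ d ] [ swap d ]) (sym (φ-++ y [ d ]))))
      ≤-refl ≤-refl

  left : ∀ {w u r} → Cut w u r → r ≡ y ++ v → Cover y w
  left (between u r) r≡ = right-between u (cut r y v r≡)
  left (within u c r) r≡ = go y 2≤y r≡
    where
    go : ∀ y → 2 ≤ length y → swap c ∷ φ r ≡ y ++ v → Cover y (u ++ c ∷ r)
    -- The first letter of y completes the block of `c`, so the rest of y starts at a block
    -- boundary.
    go (_ ∷ y) _ r≡ with refl ← ∷-injectiveˡ r≡ = right-within u c (cut r y v (∷-injectiveʳ r≡))

factor-of-block : ∀ {c} l y r → 2 ≤ length y → l ++ y ++ r ≡ φ [ c ] → y ≡ φ [ c ]
factor-of-block _               (_ ∷ [])     _ (s≤s ())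
factor-of-block []              (_ ∷ _ ∷ []) _ _ refl = refl
factor-of-block (_ ∷ [])        (_ ∷ _ ∷ _)  _ _ ()
factor-of-block (_ ∷ _ ∷ [])    (_ ∷ _ ∷ _)  _ _ ()
factor-of-block (_ ∷ _ ∷ _ ∷ _) (_ ∷ _ ∷ _)  _ _ ()

block-in-square : ∀ c → swap c ∷ φ [ c ] ++ [ c ] ≡ φ (swap c ∷ swap c ∷ [])
block-in-square a = refl
block-in-square b = refl

-- A single block φ c is not cut inside by the image of a cut, but it also occurs in the middle of
-- φ (c̄c̄) = c̄cc̄c.
cover₂ : ∀ {i y w} → Squares w → 2 ≤ length y → OccursAt i y (φ w) →
         Σ (Cover y w) λ c → 2 ≤ length (Cover.factor c)
cover₂ {y = y} squares 2≤y o with cover 2≤y o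
... | C@(covered {factor = _ ∷ _ ∷ _} _ _ _ _ _ _) = C , s≤s (s≤s z≤n)
... | covered {factor = []} _ [] _ image _ _ with () ← nonempty 2≤y (++-conicalˡ y _ image)
... | covered {factor = c ∷ []} _ l r image _ _ with refl ← factor-of-block l y r 2≤y image =
    covered (proj₂ (squares (swap c))) [ swap c ] [ c ] (block-in-square c) ≤-refl ≤-refl , ≤-refl

-- A cut strictly inside x is, after doubling, at least 2 away from both ends of φ x, so trimming
-- one letter at each end keeps it strictly inside.
straddlesAll-φ : ∀ {gs w} → Squares w → StraddlesAll gs w → StraddlesAll (map (_* 2) gs) (φ w)
straddlesAll-φ squares straddles {x = y} 2≤y o
  with covered {factor = x} o₁ l r image l≤1 r≤1 , 2≤x ← cover₂ squares 2≤y o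
  with i , g , o₂ , g∈gs , i<g , g<end ← straddles 2≤x o₁ =
    i * 2 + length l , g * 2 , occurs-trans (occurs l r image refl) (occurs-φ o₂)
      , ∈-map⁺ (_* 2) g∈gs , start< , s≤s⁻¹ <end
  where
  open ≤-Reasoning
  start< : i * 2 + length l < g * 2
  start< = begin-strict
    i * 2 + length l  ≤⟨ +-monoʳ-≤ (i * 2) l≤1 ⟩
    i * 2 + 1         ≡⟨ +-comm (i * 2) 1 ⟩
    1 + i * 2         <⟨ ≤-refl ⟩
    suc i * 2         ≤⟨ *-monoˡ-≤ 2 i<g ⟩
    g * 2             ∎
  <end : suc (suc (g * 2)) ≤ suc (i * 2 + length l + length y)
  <end = begin
    suc g * 2                                      ≤⟨ *-monoˡ-≤ 2 g<end ⟩
    (i + length x) * 2                             ≡⟨ *-distribʳ-+ 2 i (length x) ⟩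
    i * 2 + length x * 2                           ≡⟨ cong (i * 2 +_) (length-φ x) ⟨
    i * 2 + length (φ x)                           ≡⟨ cong (λ z → i * 2 + length z) image ⟨
    i * 2 + length (l ++ y ++ r)                   ≡⟨ cong (i * 2 +_) (length-++ l) ⟩
    i * 2 + (length l + length (y ++ r))           ≡⟨ +-assoc (i * 2) (length l) _ ⟨
    i * 2 + length l + length (y ++ r)             ≡⟨ cong (i * 2 + length l +_) (length-++ y) ⟩
    i * 2 + length l + (length y + length r)       ≡⟨ +-assoc (i * 2 + length l) (length y) _ ⟨
    i * 2 + length l + length y + length r         ≤⟨ +-monoʳ-≤ (i * 2 + length l + length y) r≤1 ⟩
    i * 2 + length l + length y + 1                ≡⟨ +-comm _ 1 ⟩
    suc (i * 2 + length l + length y)              ∎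

-- t₃ is a prefix of all later words, so its squares keep their starts.
squares-thueMorse : ∀ k → Squares (thueMorse (3 + k))
squares-thueMorse zero    a = 5 , occurs (a ∷ b ∷ b ∷ a ∷ b ∷ []) [ b ] refl refl
squares-thueMorse zero    b = 1 , occurs [ a ] (a ∷ b ∷ a ∷ a ∷ b ∷ []) refl refl
squares-thueMorse (suc k) c with i , occurs u v eq start ← squares-thueMorse k c =
  i , occurs u (v ++ complement (thueMorse (3 + k)))
        (trans (sym (++-assoc u (c ∷ c ∷ v) _)) (cong (_++ complement (thueMorse (3 + k))) eq)) start

-- `cuts k` is meant for `thueMorse (3 + k)`; the base lists the cuts of ab|b|a|ba|ab.
cuts : ℕ → List ℕ
cuts zero    = 2 ∷ 3 ∷ 4 ∷ 6 ∷ []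
cuts (suc k) = map (_* 2) (cuts k)

length-cuts : ∀ k → length (cuts k) ≡ 4
length-cuts zero    = refl
length-cuts (suc k) = trans (length-map (_* 2) (cuts k)) (length-cuts k)

-- Stated by start and length, both at most 8, so that t₃ is settled by a bounded decidable check.
-- The blocks are exceptions because ab at 0 and 6 and ba at 4 cross no cut.
CrossesCutOrBlock : ℕ → ℕ → Set
CrossesCutOrBlock i l =
  Any (λ g → i < g × g < i + l) (cuts 0) ⊎
  take l (drop i (thueMorse 3)) ≡ φ [ a ] ⊎ take l (drop i (thueMorse 3)) ≡ φ [ b ]

crossesCutOrBlock : ∀ {i} → i < 9 → ∀ {l} → l < 9 → 2 ≤ l → i + l ≤ 8 → CrossesCutOrBlock i l
crossesCutOrBlock = toWitness {a? = allUpTo? (λ i → allUpTo? (λ l →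
  2 ≤? l →-dec i + l ≤? 8 →-dec
    (any? (λ g → i <? g ×-dec g <? i + l) (cuts 0) ⊎-dec
     take l (drop i (thueMorse 3)) ≟ʷ φ [ a ] ⊎-dec take l (drop i (thueMorse 3)) ≟ʷ φ [ b ])) 9) 9} _

straddlesAll-t₃ : StraddlesAll (cuts 0) (thueMorse 3)
straddlesAll-t₃ {i} {x} 2≤x o
  with crossesCutOrBlock (s≤s (m+n≤o⇒m≤o i (occurs-bound o))) (s≤s (m+n≤o⇒n≤o i (occurs-bound o)))
                         2≤x (occurs-bound o)
... | inj₁ crossing with g , g∈ , i<g , g<end ← find crossing = i , g , o , g∈ , i<g , g<end
-- The exceptions recur across a cut: ab at 3 and ba at 2.
... | inj₂ (inj₁ x≡ab) with refl ← trans (sym (occurs-take o)) x≡ab =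
  3 , 4 , occurs (a ∷ b ∷ b ∷ []) (a ∷ a ∷ b ∷ []) refl refl , there (there (here refl)) , ≤-refl , ≤-refl
... | inj₂ (inj₂ x≡ba) with refl ← trans (sym (occurs-take o)) x≡ba =
  2 , 3 , occurs (a ∷ b ∷ []) (b ∷ a ∷ a ∷ b ∷ []) refl refl , there (here refl) , ≤-refl , ≤-refl

straddlesAll-thueMorse : ∀ k → StraddlesAll (cuts k) (thueMorse (3 + k))
straddlesAll-thueMorse zero    = straddlesAll-t₃
straddlesAll-thueMorse (suc k) =
  subst (StraddlesAll (cuts (suc k))) (sym (thueMorse-suc (3 + k)))
    (straddlesAll-φ (squares-thueMorse k) (straddlesAll-thueMorse k))

-- If a cut lies inside an occurrence, so does the letter to its right. A cut inside cc has the
-- second c on its right, which serves the single letter c.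
straddlesAll⇒hits : ∀ {gs w i x} → Squares w → StraddlesAll gs w → x ≢ [] → OccursAt i x w → Hits gs x w
straddlesAll⇒hits {x = []}        _       _         x≢[] _ = contradiction refl x≢[]
straddlesAll⇒hits {x = c ∷ []}    squares straddles _    _
  with i , g , o , g∈gs , i<g , g<end ← straddles ≤-refl (proj₂ (squares c)) =
    i + 1 , g , occurs-trans (occurs [ c ] [] refl refl) o , g∈gs
      , subst (_≤ g) (+-comm 1 i) i<g , subst (g <_) (sym (+-assoc i 1 1)) g<end
straddlesAll⇒hits {x = _ ∷ _ ∷ _} _       straddles _    o
  with i , g , o′ , g∈gs , i<g , g<end ← straddles (s≤s (s≤s z≤n)) o =
    i , g , o′ , g∈gs , <⇒≤ i<g , g<end

-- From lists of positions to subsets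

subset : ∀ n → List ℕ → Subset n
subset n []       = ⊥
subset n (p ∷ ps) with p <? n
... | yes p<n = ⁅ fromℕ< p<n ⁆ ∪ subset n ps
... | no  _   = subset n ps

∣p∪q∣≤∣p∣+∣q∣ : ∀ {n} (p q : Subset n) → ∣ p ∪ q ∣ ≤ ∣ p ∣ + ∣ q ∣
∣p∪q∣≤∣p∣+∣q∣ []            []            = z≤n
∣p∪q∣≤∣p∣+∣q∣ (outside ∷ p) (outside ∷ q) = ∣p∪q∣≤∣p∣+∣q∣ p q
∣p∪q∣≤∣p∣+∣q∣ (outside ∷ p) (inside ∷ q)  =
  ≤-trans (s≤s (∣p∪q∣≤∣p∣+∣q∣ p q)) (≤-reflexive (sym (+-suc ∣ p ∣ ∣ q ∣)))
∣p∪q∣≤∣p∣+∣q∣ (inside ∷ p)  (outside ∷ q) = s≤s (∣p∪q∣≤∣p∣+∣q∣ p q)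
∣p∪q∣≤∣p∣+∣q∣ (inside ∷ p)  (inside ∷ q)  =
  s≤s (≤-trans (∣p∪q∣≤∣p∣+∣q∣ p q) (+-monoʳ-≤ ∣ p ∣ (n≤1+n ∣ q ∣)))

∣subset∣≤length : ∀ n ps → ∣ subset n ps ∣ ≤ length ps
∣subset∣≤length n []       = ≤-reflexive (∣⊥∣≡0 n)
∣subset∣≤length n (p ∷ ps) with p <? n
... | yes p<n = ≤-trans (∣p∪q∣≤∣p∣+∣q∣ ⁅ fromℕ< p<n ⁆ (subset n ps))
                  (+-mono-≤ (≤-reflexive (∣⁅x⁆∣≡1 (fromℕ< p<n))) (∣subset∣≤length n ps))
... | no  _   = m≤n⇒m≤1+n (∣subset∣≤length n ps)

∈-subset : ∀ {n p ps} (p<n : p < n) → p ∈ ps → fromℕ< p<n ∈ₛ subset n ps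
∈-subset {n} {p} {q ∷ _} p<n p∈ with q <? n | p∈
... | yes q<n | here refl  = x∈p∪q⁺ (inj₁ (x∈⁅x⁆ _))
... | yes _   | there p∈ps = x∈p∪q⁺ (inj₂ (∈-subset p<n p∈ps))
... | no q≮n  | here refl  = contradiction p<n q≮n
... | no _    | there p∈ps = ∈-subset p<n p∈ps

hits⇒attractor : ∀ {ps w} → (∀ {i x} → x ≢ [] → OccursAt i x w → Hits ps x w) →
                 IsStringAttractor w (subset (length w) ps)
hits⇒attractor hits [] x≢[] _ = contradiction refl x≢[]
-- Splitting off the first letter makes the last position i + |x′|, with no subtraction.
hits⇒attractor {w = w} hits x@(_ ∷ x′) x≢[] x⊑w
  with i , p , o , p∈ps , i≤p , p<end ← hits x≢[] (proj₂ (substring⇒occurs x⊑w)) =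
    fromℕ< i< , fromℕ< j<
      , subst₂ _≤_ (sym i≡) (sym j≡) (m≤m+n i (length x′))
      , trans (cong₂ (λ m n → take (suc (n ∸ m)) (drop m w)) i≡ j≡)
          (trans (cong (λ l → take (suc l) (drop i w)) (m+n∸m≡n i (length x′))) (occurs-take o))
      , fromℕ< p< , ∈-subset p< p∈ps
      , subst₂ _≤_ (sym i≡) (sym p≡) i≤p , subst₂ _≤_ (sym p≡) (sym j≡) p≤j
  where
  j< : i + length x′ < length w
  j< = subst (_≤ length w) (+-suc i (length x′)) (occurs-bound o)
  p≤j : p ≤ i + length x′
  p≤j = s≤s⁻¹ (subst (p <_) (+-suc i (length x′)) p<end)
  p< : p < length w
  p< = ≤-<-trans p≤j j<
  i< : i < length w
  i< = ≤-<-trans i≤p p<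
  i≡ : toℕ (fromℕ< i<) ≡ i
  i≡ = toℕ-fromℕ< i<
  j≡ : toℕ (fromℕ< j<) ≡ i + length x′
  j≡ = toℕ-fromℕ< j<
  p≡ : toℕ (fromℕ< p<) ≡ p
  p≡ = toℕ-fromℕ< p<

-- The value of γ

theorem3 : ∀ (n : ℕ) → 4 ≤ n → γ (thueMorse n) ≔ 4
theorem3 n 4≤n with k , refl ← m≤n⇒∃[o]m+o≡n 4≤n =
  -- The construction only bounds the size of Γ from above; the lower bound, applied to Γ itself,
  -- gives equality.
  (Γ , attracts , ≤-antisym ∣Γ∣≤4 (least Γ attracts)) , least
  where
  w : Word
  w = thueMorse (4 + k)
  Γ : Subset (length w)
  Γ = subset (length w) (cuts (suc k))
  attracts : IsStringAttractor w Γ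
  attracts = hits⇒attractor
    (straddlesAll⇒hits (squares-thueMorse (suc k)) (straddlesAll-thueMorse (suc k)))
  ∣Γ∣≤4 : ∣ Γ ∣ ≤ 4
  ∣Γ∣≤4 = ≤-trans (∣subset∣≤length (length w) (cuts (suc k))) (≤-reflexive (length-cuts (suc k)))
  least : ∀ Γ → IsStringAttractor w Γ → 4 ≤ ∣ Γ ∣
  least Γ attracts =
    subst (4 ≤_) (length-positions Γ) (hitsAll-thueMorse k (attractor⇒hitsAll attracts))
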